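{- Let $\mathcal{Q}$ be a quasivariety of algebras with a majority term and let $\mathcal{S}=\mathbb{P}_u(\mathcal{Q}_{RSI})$. The following are equivalent: (1) $\mathcal{Q}$ has surjective epimorphisms. (2) For all $\mathbf{A},\mathbf{B}\in\mathcal{Q}$, if $\mathbf{A}\leq_e\mathbf{B}$ in $\mathcal{Q}$, then $\mathbf{A}=\mathbf{B}$. (3) For all $\mathbf{A},\mathbf{B}\in\mathbb{S}(\mathcal{S}\times\mathcal{S})$, if $\mathbf{A}\leq_e\mathbf{B}$ in $\mathcal{S}\times\mathcal{S}$, then $\mathbf{A}=\mathbf{B}$. (4) $\mathbb{S}(\mathcal{S}\times\mathcal{S})$ has surjective epimorphisms.
   Context: All languages are algebraic (no relation symbols); algebras are nonempty. $\mathbb{S}$ and $\mathbb{P}_u$ denote the class operators of taking subalgebras and ultraproducts. $\mathcal{S}\times\mathcal{S}:=\{\mathbf{C}\times\mathbf{D}\mid\mathbf{C},\mathbf{D}\in\mathcal{S}\}$. A majority term for a class is a term $t(x_1,x_2,x_3)$ such that the class satisfies $t(x,x,y)=t(x,y,x)=t(y,x,x)=x$. An algebra $\mathbf{A}\in\mathcal{Q}$ is relatively subdirectly irreducible if its diagonal congruence is completely meet irreducible in the lattice of $\mathcal{Q}$-congruences of $\mathbf{A}$ (congruences $\theta$ with $\mathbf{A}/\theta\in\mathcal{Q}$); $\mathcal{Q}_{RSI}$ is the class of relatively subdirectly irreducible members of $\mathcal{Q}$. For a class $\mathcal{K}$, $\mathbf{A}\leq_e\mathbf{B}$ in $\mathcal{K}$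 ($\mathbf{A}$ is an epic subalgebra of $\mathbf{B}$ in $\mathcal{K}$) means that $\mathbf{A}$ is a subalgebra of $\mathbf{B}$ and for every $\mathbf{C}\in\mathcal{K}$ and all homomorphisms $g,g':\mathbf{B}\to\mathbf{C}$ with $g|_A=g'|_A$ we have $g=g'$. For $\mathbf{A},\mathbf{B}\in\mathcal{K}$, a homomorphism $h:\mathbf{A}\to\mathbf{B}$ is a $\mathcal{K}$-epimorphism if for every $\mathbf{C}\in\mathcal{K}$ and homomorphisms $g,g':\mathbf{B}\to\mathbf{C}$, $gh=g'h$ implies $g=g'$. $\mathcal{K}$ has surjective epimorphisms if every $\mathcal{K}$-epimorphism (between members of $\mathcal{K}$) is surjective. -}

module Defs where

open import Level using (Level; _⊔_; Setω) renaming (suc to lsuc)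
open import Data.Nat.Base using (ℕ)
open import Data.Fin.Base using (Fin; zero; suc)
open import Data.List.Base using (List)
open import Data.List.Relation.Unary.All using (All)
open import Data.Product.Base using (Σ; Σ-syntax; ∃-syntax; _×_; _,_; proj₁; proj₂)
open import Data.Product.Relation.Binary.Pointwise.NonDependent using (×-setoid)
open import Data.Sum.Base using (_⊎_)
open import Data.Vec.Functional using (Vector; []; _∷_)
open import Function.Base using (_∘_)
open import Function.Bundles using (Func)
open import Function.Definitions using (Bijective; Surjective)
open import Relation.Binary.Bundles using (Setoid; Poset)
open import Relation.Binary.Core using (Rel)
open import Relation.Binary.Structures using (IsEquivalence)
import Relation.Binary.Construct.On as On
open import Relation.Nullary.Negation.Core using (¬_)
open import Relation.Unary using (Pred; _∈_; _⊆_; _∩_; ∁; Universal; Satisfiable)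
open import Relation.Unary.Polymorphic using (U; ∅)

private
  variable
    c ℓ ℓ₁ ℓ₂ κ μ : Level

infixl 7 _/_ _×ᴬ_ _⊗_
infix 4 _≅_ _⊨_

module _ (P : Poset c ℓ₁ ℓ₂) where
  open Poset P

  IsChain : Pred Carrier ℓ → Set (c ⊔ ℓ₂ ⊔ ℓ)
  IsChain C = ∀ x y → x ∈ C → y ∈ C → x ≤ y ⊎ y ≤ x

  IsLowerBound : Pred Carrier ℓ → Carrier → Set (c ⊔ ℓ₂ ⊔ ℓ)
  IsLowerBound X m = ∀ x → x ∈ X → m ≤ x

  IsUpperBound : Pred Carrier ℓ → Carrier → Set (c ⊔ ℓ₂ ⊔ ℓ)
  IsUpperBound X m = ∀ x → x ∈ X → x ≤ m

  IsInfimum : Pred Carrier ℓ → Carrier → Set (c ⊔ ℓ₂ ⊔ ℓ)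
  IsInfimum X m = IsLowerBound X m × (∀ n → IsLowerBound X n → n ≤ m)

  IsMaximal : Carrier → Set (c ⊔ ℓ₁ ⊔ ℓ₂)
  IsMaximal m = ∀ x → m ≤ x → x ≈ m

  -- X may be empty, so the top element is not completely meet irreducible.
  CompletelyMeetIrreducible : Carrier → Set (lsuc c ⊔ ℓ₁ ⊔ ℓ₂)
  CompletelyMeetIrreducible m =
    (X : Pred Carrier c) → IsInfimum X m → ∃[ x ] x ∈ X × x ≈ m

-- The form in which the axiom of choice is assumed.  The empty chain is
-- included, so the hypothesis forces P to be inhabited.
ZornsLemma : Setω
ZornsLemma = ∀ {c ℓ₁ ℓ₂} (P : Poset c ℓ₁ ℓ₂) →
  ((C : Pred (Poset.Carrier P) c) → IsChain P C → ∃[ u ] IsUpperBound P C u) →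
  ∃[ m ] IsMaximal P m

record Signature (ℓ : Level) : Set (lsuc ℓ) where
  field
    Op    : Set ℓ
    arity : Op → ℕ

open Signature public

private
  variable
    𝓛 : Signature ℓ

record Algebra {ℓ} (𝓛 : Signature ℓ) : Set (lsuc ℓ) where
  field
    setoid : Setoid ℓ ℓ
  open Setoid setoid public
  field
    op       : (f : Op 𝓛) → Vector Carrier (arity 𝓛 f) → Carrier
    op-cong  : ∀ f {xs ys} → (∀ i → xs i ≈ ys i) → op f xs ≈ op f ys
    nonempty : Carrier

record Hom {𝓛 : Signature ℓ} (A B : Algebra 𝓛) : Set ℓ where
  private
    module A = Algebra A
    module B = Algebra B
  field
    func : Func A.setoid B.setoid
  open Func func public using (to; cong)
  field
    homo : ∀ f xs → to (A.op f xs) B.≈ B.op f (to ∘ xs)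

open Hom public using (to)

_≅_ : {𝓛 : Signature ℓ} → Algebra 𝓛 → Algebra 𝓛 → Set ℓ
A ≅ B = Σ[ h ∈ Hom A B ] Bijective (Algebra._≈_ A) (Algebra._≈_ B) (to h)

data Term (𝓛 : Signature ℓ) (X : Set) : Set ℓ where
  var  : X → Term 𝓛 X
  node : (f : Op 𝓛) → Vector (Term 𝓛 X) (arity 𝓛 f) → Term 𝓛 X

⟦_⟧ : {X : Set} → Term 𝓛 X → (A : Algebra 𝓛) →
      (X → Algebra.Carrier A) → Algebra.Carrier A
⟦ var x     ⟧ A ρ = ρ x
⟦ node f ts ⟧ A ρ = Algebra.op A f (λ i → ⟦ ts i ⟧ A ρ)

Equation : Signature ℓ → Set ℓ
Equation 𝓛 = Term 𝓛 ℕ × Term 𝓛 ℕ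

record QuasiEquation (𝓛 : Signature ℓ) : Set ℓ where
  field
    premises   : List (Equation 𝓛)
    conclusion : Equation 𝓛

module _ {𝓛 : Signature ℓ} (A : Algebra 𝓛) where
  open Algebra A

  Holds : (ℕ → Carrier) → Equation 𝓛 → Set ℓ
  Holds ρ (s , t) = ⟦ s ⟧ A ρ ≈ ⟦ t ⟧ A ρ

_⊨_ : {𝓛 : Signature ℓ} → Algebra 𝓛 → QuasiEquation 𝓛 → Set ℓ
A ⊨ q = ∀ ρ → All (Holds A ρ) premises → Holds A ρ conclusion
  where open QuasiEquation q

Class : Signature ℓ → (κ : Level) → Set (lsuc ℓ ⊔ lsuc κ)
Class 𝓛 κ = Pred (Algebra 𝓛) κ

Quasivariety : {𝓛 : Signature ℓ} → Pred (QuasiEquation 𝓛) ℓ → Class 𝓛 ℓ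
Quasivariety Γ A = ∀ q → q ∈ Γ → A ⊨ q

HasMajorityTerm : {𝓛 : Signature ℓ} → Class 𝓛 κ → Set (lsuc ℓ ⊔ κ)
HasMajorityTerm {𝓛 = 𝓛} K = Σ[ t ∈ Term 𝓛 (Fin 3) ] (∀ A → A ∈ K →
  let open Algebra A
      m : Carrier → Carrier → Carrier → Carrier
      m x y z = ⟦ t ⟧ A (x ∷ y ∷ z ∷ [])
  in ∀ x y → m x x y ≈ x × m x y x ≈ x × m y x x ≈ x)

record Subuniverse {𝓛 : Signature ℓ} (B : Algebra 𝓛) : Set (lsuc ℓ) where
  open Algebra B
  field
    carrier  : Pred Carrier ℓ
    resp     : ∀ {x y} → x ≈ y → x ∈ carrier → y ∈ carrier
    closed   : ∀ f xs → (∀ i → xs i ∈ carrier) → op f xs ∈ carrier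
    nonempty : Satisfiable carrier

open Subuniverse public using (carrier)

subalgebra : {𝓛 : Signature ℓ} (B : Algebra 𝓛) → Subuniverse B → Algebra 𝓛
subalgebra B A = record
  { setoid   = On.setoid {B = Σ _ (carrier A)} B.setoid proj₁
  ; op       = λ f xs → B.op f (proj₁ ∘ xs) , A.closed f (proj₁ ∘ xs) (proj₂ ∘ xs)
  ; op-cong  = λ f → B.op-cong f
  ; nonempty = A.nonempty
  }
  where
  module A = Subuniverse A
  module B = Algebra B

_×ᴬ_ : Algebra 𝓛 → Algebra 𝓛 → Algebra 𝓛
C ×ᴬ D = record
  { setoid   = ×-setoid C.setoid D.setoid
  ; op       = λ f xs → C.op f (proj₁ ∘ xs) , D.op f (proj₂ ∘ xs)
  ; op-cong  = λ f eq → C.op-cong f (proj₁ ∘ eq) , D.op-cong f (proj₂ ∘ eq)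
  ; nonempty = C.nonempty , D.nonempty
  }
  where
  module C = Algebra C
  module D = Algebra D

record Ultrafilter (I : Set ℓ) : Set (lsuc ℓ) where
  field
    Large  : Pred (Pred I ℓ) ℓ
    upward : ∀ {X Y} → X ⊆ Y → Large X → Large Y
    whole  : Large U
    inter  : ∀ {X Y} → Large X → Large Y → Large (X ∩ Y)
    proper : ¬ Large ∅
    ultra  : ∀ X → Large X ⊎ Large (∁ X)

ultraproduct : {𝓛 : Signature ℓ} {I : Set ℓ} →
               Ultrafilter I → (I → Algebra 𝓛) → Algebra 𝓛
ultraproduct {I = I} 𝓤 A = record
  { setoid   = record
    { Carrier       = ∀ i → A.Carrier i
    ; _≈_           = λ a b → Large (λ i → A._≈_ i (a i) (b i))
    ; isEquivalence = record
      { refl  = upward (λ {i} _ → A.refl i) whole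
      ; sym   = upward (λ {i} → A.sym i)
      ; trans = λ p q → upward (λ {i} (r , s) → A.trans i r s) (inter p q)
      }
    }
  ; op       = λ f as i → A.op i f (λ j → as j i)
  ; op-cong  = λ f eq → upward (λ {i} → A.op-cong i f) (all eq)
  ; nonempty = λ i → A.nonempty i
  }
  where
  open Ultrafilter 𝓤
  module A i = Algebra (A i)

  all : ∀ {n} {X : Fin n → Pred I _} →
        (∀ j → Large (X j)) → Large (λ i → ∀ j → X j i)
  all {ℕ.zero}  _ = upward (λ _ ()) whole
  all {ℕ.suc n} p = upward (λ { (x , _) zero → x ; (_ , y) (suc j) → y j })
                         (inter (p zero) (all (p ∘ suc)))

-- 𝕊, ℙᵤ and ⊗ are closed under isomorphism, as algebras have no other
-- meaningful equality.

𝕊 : {𝓛 : Signature ℓ} → Class 𝓛 κ → Class 𝓛 (lsuc ℓ ⊔ κ)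
𝕊 K A = ∃[ B ] B ∈ K × Σ[ P ∈ Subuniverse B ] A ≅ subalgebra B P

ℙᵤ : {𝓛 : Signature ℓ} → Class 𝓛 κ → Class 𝓛 (lsuc ℓ ⊔ κ)
ℙᵤ {ℓ = ℓ} {𝓛 = 𝓛} K A =
  Σ[ I ∈ Set ℓ ] Σ[ 𝓤 ∈ Ultrafilter I ] Σ[ B ∈ (I → Algebra 𝓛) ]
    (∀ i → B i ∈ K) × A ≅ ultraproduct 𝓤 B

_⊗_ : {𝓛 : Signature ℓ} → Class 𝓛 κ → Class 𝓛 μ → Class 𝓛 (lsuc ℓ ⊔ κ ⊔ μ)
(K ⊗ L) A = ∃[ C ] ∃[ D ] C ∈ K × D ∈ L × A ≅ (C ×ᴬ D)

record Congruence {𝓛 : Signature ℓ} (A : Algebra 𝓛) : Set (lsuc ℓ) where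
  open Algebra A using (Carrier; _≈_; op)
  field
    _∼_           : Rel Carrier ℓ
    reflexive     : ∀ {x y} → x ≈ y → x ∼ y
    isEquivalence : IsEquivalence _∼_
    compatible    : ∀ f {xs ys} → (∀ i → xs i ∼ ys i) → op f xs ∼ op f ys

_/_ : {𝓛 : Signature ℓ} (A : Algebra 𝓛) → Congruence A → Algebra 𝓛
A / θ = record
  { setoid   = record { isEquivalence = θ.isEquivalence }
  ; op       = A.op
  ; op-cong  = θ.compatible
  ; nonempty = A.nonempty
  }
  where
  module A = Algebra A
  module θ = Congruence θ

diagonal : {𝓛 : Signature ℓ} (A : Algebra 𝓛) → Congruence A
diagonal A = record
  { _∼_           = _≈_
  ; reflexive     = λ p → p
  ; isEquivalence = isEquivalence
  ; compatible    = op-cong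
  }
  where open Algebra A

module _ {𝓛 : Signature ℓ} (K : Class 𝓛 κ) (A : Algebra 𝓛) where

  RelCongruence : Set (lsuc ℓ ⊔ κ)
  RelCongruence = Σ[ θ ∈ Congruence A ] (A / θ) ∈ K

  -- Ordered by inclusion; equality is mutual inclusion.
  relCongruences : Poset (lsuc ℓ ⊔ κ) ℓ ℓ
  relCongruences = record
    { Carrier        = RelCongruence
    ; _≈_            = λ θ ψ → θ ⊑ ψ × ψ ⊑ θ
    ; _≤_            = _⊑_
    ; isPartialOrder = record
      { isPreorder = record
        { isEquivalence = record
          { refl  = (λ p → p) , (λ p → p)
          ; sym   = λ (p , q) → q , p
          ; trans = λ (p , q) (r , s) → (λ z → r (p z)) , (λ z → q (s z))
          }
        ; reflexive = proj₁
        ; trans     = λ p q z → q (p z)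
        }
      ; antisym    = _,_
      }
    }
    where
    _⊑_ : RelCongruence → RelCongruence → Set ℓ
    (θ , _) ⊑ (ψ , _) = ∀ {x y} → Congruence._∼_ θ x y → Congruence._∼_ ψ x y

-- A and A / diagonal A differ only in their proof fields, so membership of
-- the latter in K is no restriction when K is a quasivariety.
RSI : {𝓛 : Signature ℓ} → Class 𝓛 κ → Class 𝓛 (lsuc (lsuc ℓ) ⊔ lsuc κ)
RSI K A = A ∈ K × (Σ[ Δ∈K ∈ (A / diagonal A) ∈ K ]
  CompletelyMeetIrreducible (relCongruences K A) (diagonal A , Δ∈K))

module _ {𝓛 : Signature ℓ} (K : Class 𝓛 κ) where

  IsEpimorphism : {A B : Algebra 𝓛} → Hom A B → Set (lsuc ℓ ⊔ κ)
  IsEpimorphism {A} {B} h = ∀ C → C ∈ K → (g g′ : Hom B C) → let open Algebra C in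
    (∀ a → to g (to h a) ≈ to g′ (to h a)) → ∀ b → to g b ≈ to g′ b

  IsEpic : {B : Algebra 𝓛} → Subuniverse B → Set (lsuc ℓ ⊔ κ)
  IsEpic {B} A = ∀ C → C ∈ K → (g g′ : Hom B C) → let open Algebra C in
    (∀ a → a ∈ carrier A → to g a ≈ to g′ a) → ∀ b → to g b ≈ to g′ b

  HasSurjectiveEpimorphisms : Set (lsuc ℓ ⊔ κ)
  HasSurjectiveEpimorphisms = ∀ A B → A ∈ K → B ∈ K → (h : Hom A B) →
    IsEpimorphism h → Surjective (Algebra._≈_ A) (Algebra._≈_ B) (to h)

-- Subalgebras and their overalgebras range over L, epicness is tested in K.
NoProperEpicSubalgebras : {𝓛 : Signature ℓ} →
                          Class 𝓛 μ → Class 𝓛 κ → Set (lsuc ℓ ⊔ μ ⊔ κ)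
NoProperEpicSubalgebras L K = ∀ B (A : Subuniverse B) →
  subalgebra B A ∈ L → B ∈ L → IsEpic K A → Universal (carrier A)

{-# OPTIONS --safe #-}

-- For (3) ⇒ (2), let A be epic in B and b ∈ B, and choose for every pair of
-- distinct elements of B a homomorphism gᵢ from B to a relatively subdirectly
-- irreducible algebra separating them.  The image of A in a product of two
-- members of S is epic in the image of B, so by (3) any two homomorphisms from B
-- to members of S agree with b at a common a ∈ A.  As S contains the
-- ultraproducts of the targets, compactness gives finitely many elements of A one
-- of which works for any given pair (gᵢ , gⱼ).  The majority term then merges
-- them, as in the Baker–Pixley theorem, into one a ∈ A with gᵢ a ≈ gᵢ b for all
-- i, and a ≈ b because the gᵢ separate points.
module Submission where

open import Defs
open import Axiom.ExcludedMiddle using (ExcludedMiddle)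
open import Data.Fin.Base using (Fin; zero; suc; punchIn)
open import Data.List.Base using (List; []; _∷_; [_]; _++_; map; length; lookup)
import Data.List.Membership.Propositional as Membership
open import Data.List.Membership.Propositional.Properties using (∈-lookup)
open import Data.List.Relation.Unary.All as All using (All; []; _∷_)
import Data.List.Relation.Unary.All.Properties as All
open import Data.List.Relation.Unary.Any as Any using (Any; here)
import Data.List.Relation.Unary.Any.Properties as Any
open import Data.Nat.Base using (zero; suc)
open import Data.Product.Base
  using (Σ; Σ-syntax; ∃-syntax; _×_; _,_; proj₁; proj₂; uncurry; curry; -,_)
open import Data.Sum.Base using (_⊎_; inj₁; inj₂)
open import Data.Unit.Polymorphic.Base using (⊤)
import Data.Vec.Functional as Vector
open import Function.Base using (id; _∘_; _∘′_; _on_)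
open import Function.Bundles using (_⇔_; mk⇔; Equivalence)
open import Function.Construct.Composition using (_⇔-∘_)
open import Function.Construct.Symmetry using (⇔-sym)
open import Function.Definitions using (Injective)
open import Level using (Level; _⊔_; Lift; lift; lower) renaming (suc to lsuc)
open import Relation.Binary.Bundles using (Poset)
open import Relation.Binary.Structures using (IsEquivalence)
open import Relation.Nullary.Decidable
  using (Dec; yes; no; True; toWitness; fromWitness; decidable-stable; toSum)
open import Relation.Nullary.Negation using (¬_; contradiction)
open import Relation.Unary
  using (Pred; _∈_; _⊆_; _∩_; ∁; Satisfiable; Universal)
open import Relation.Unary.Polymorphic using (∅)

private
  variable
    a c i p x ℓ κ μ : Level
    𝓛 : Signature ℓ
    A B C D : Algebra 𝓛

-- Homomorphisms and terms

infixr 9 _∘ᴴ_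

_∘ᴴ_ : Hom B C → Hom A B → Hom A C
_∘ᴴ_ {C = C} g f = record
  { func = record { to = to g ∘ to f ; cong = λ e → Hom.cong g (Hom.cong f e) }
  ; homo = λ o xs → Algebra.trans C (Hom.cong g (Hom.homo f o xs)) (Hom.homo g o _)
  }

⟨_,_⟩ : Hom A B → Hom A C → Hom A (B ×ᴬ C)
⟨ f , g ⟩ = record
  { func = record
    { to   = λ z → to f z , to g z
    ; cong = λ e → Hom.cong f e , Hom.cong g e
    }
  ; homo = λ o xs → Hom.homo f o xs , Hom.homo g o xs
  }

idᴴ : Hom A A
idᴴ {A = A} = record
  { func = record { to = id ; cong = id }
  ; homo = λ _ _ → Algebra.refl A
  }

π₁ : Hom (A ×ᴬ B) A
π₁ {A = A} = record
  { func = record { to = proj₁ ; cong = proj₁ }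
  ; homo = λ _ _ → Algebra.refl A
  }

π₂ : Hom (A ×ᴬ B) B
π₂ {B = B} = record
  { func = record { to = proj₂ ; cong = proj₂ }
  ; homo = λ _ _ → Algebra.refl B
  }

inclusion : (P : Subuniverse B) → Hom (subalgebra B P) B
inclusion {B = B} P = record
  { func = record { to = proj₁ ; cong = id }
  ; homo = λ _ _ → Algebra.refl B
  }

quotient-map : (θ : Congruence A) → Hom A (A / θ)
quotient-map {A = A} θ = record
  { func = record { to = id ; cong = reflexive }
  ; homo = λ _ _ → reflexive (Algebra.refl A)
  }
  where open Congruence θ

kernel : Hom A B → Congruence A
kernel {A = A} {B = B} h = record
  { _∼_           = B._≈_ on to h
  ; reflexive     = Hom.cong h
  ; isEquivalence = record { refl = B.refl ; sym = B.sym ; trans = B.trans }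
  ; compatible    = λ f e → B.trans (Hom.homo h f _)
                      (B.trans (B.op-cong f e) (B.sym (Hom.homo h f _)))
  }
  where module B = Algebra B

kernel-map : (h : Hom A B) → Hom (A / kernel h) B
kernel-map h = record
  { func = record { to = to h ; cong = id }
  ; homo = Hom.homo h
  }

IsEmbedding : {A B : Algebra 𝓛} → Hom A B → Set _
IsEmbedding {A = A} {B} h = Injective (Algebra._≈_ A) (Algebra._≈_ B) (to h)

direct-image : Hom A B → Subuniverse A → Subuniverse B
direct-image {A = A} {B = B} h P = record
  { carrier  = λ y → ∃[ z ] z ∈ carrier P × to h z B.≈ y
  ; resp     = λ e (z , z∈P , e′) → z , z∈P , B.trans e′ e
  ; closed   = λ f xs zs →
      -, P.closed f (proj₁ ∘ zs) (proj₁ ∘ proj₂ ∘ zs) ,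
      B.trans (Hom.homo h f _) (B.op-cong f (proj₂ ∘ proj₂ ∘ zs))
  ; nonempty = -, -, proj₂ P.nonempty , B.refl
  }
  where
  module B = Algebra B
  module P = Subuniverse P

full : Subuniverse A
full {A = A} = record
  { carrier  = λ _ → ⊤
  ; resp     = λ _ _ → _
  ; closed   = λ _ _ _ → _
  ; nonempty = Algebra.nonempty A , _
  }

eval-cong : ∀ {X} (A : Algebra 𝓛) (t : Term 𝓛 X) {ρ σ} → let open Algebra A in
            (∀ v → ρ v ≈ σ v) → ⟦ t ⟧ A ρ ≈ ⟦ t ⟧ A σ
eval-cong A (var v)     e = e v
eval-cong A (node f ts) e = Algebra.op-cong A f (λ j → eval-cong A (ts j) e)

eval-hom : ∀ {X} (h : Hom A B) (t : Term _ X) ρ → let open Algebra B in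
           to h (⟦ t ⟧ A ρ) ≈ ⟦ t ⟧ B (to h ∘ ρ)
eval-hom {B = B} h (var v)     ρ = Algebra.refl B
eval-hom {B = B} h (node f ts) ρ =
  trans (Hom.homo h f _) (op-cong f (λ j → eval-hom h (ts j) ρ))
  where open Algebra B

eval-closed : ∀ {X} (P : Subuniverse A) (t : Term _ X) {ρ} →
              (∀ v → ρ v ∈ carrier P) → ⟦ t ⟧ A ρ ∈ carrier P
eval-closed P (var v)     ρ∈P = ρ∈P v
eval-closed P (node f ts) ρ∈P =
  Subuniverse.closed P f _ (λ j → eval-closed P (ts j) ρ∈P)

eval-ultraproduct : ∀ {𝓛 : Signature ℓ} {I : Set ℓ} (𝓤 : Ultrafilter I) (A : I → Algebra 𝓛)
  {X} (t : Term 𝓛 X) ρ k →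
  Algebra._≈_ (A k) (⟦ t ⟧ (ultraproduct 𝓤 A) ρ k) (⟦ t ⟧ (A k) (λ v → ρ v k))
eval-ultraproduct 𝓤 A (var v)     ρ k = Algebra.refl (A k)
eval-ultraproduct 𝓤 A (node f ts) ρ k =
  Algebra.op-cong (A k) f (λ j → eval-ultraproduct 𝓤 A (ts j) ρ k)

Holds-hom : (h : Hom A B) {ρ : _} → ∀ e → Holds A ρ e → Holds B (to h ∘ ρ) e
Holds-hom {B = B} h (s , t) eq =
  trans (sym (eval-hom h s _)) (trans (Hom.cong h eq) (eval-hom h t _))
  where open Algebra B

open Congruence using (_∼_; isEquivalence; compatible; reflexive)
module ≡ {ℓ} {𝓛 : Signature ℓ} {A : Algebra 𝓛} (θ : Congruence A) = IsEquivalence (isEquivalence θ)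

Holds-quotient⇒ : (θ : Congruence A) {ρ : _} → ∀ e → Holds (A / θ) ρ e →
                  _∼_ θ (⟦ proj₁ e ⟧ A ρ) (⟦ proj₂ e ⟧ A ρ)
Holds-quotient⇒ θ (s , t) eq = ≡.trans θ (eval-hom (quotient-map θ) s _)
  (≡.trans θ eq (≡.sym θ (eval-hom (quotient-map θ) t _)))

Holds-quotient⇐ : (θ : Congruence A) {ρ : _} → ∀ e →
                  _∼_ θ (⟦ proj₁ e ⟧ A ρ) (⟦ proj₂ e ⟧ A ρ) → Holds (A / θ) ρ e
Holds-quotient⇐ θ (s , t) eq = ≡.trans θ (≡.sym θ (eval-hom (quotient-map θ) s _))
  (≡.trans θ eq (eval-hom (quotient-map θ) t _))

-- Quasivarieties

module _ {𝓛 : Signature ℓ} (Γ : Pred (QuasiEquation 𝓛) ℓ) where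

  private
    Q = Quasivariety Γ

  -- Premises push forward along each `h j`, and joint injectivity pulls the conclusion back. The
  -- level of `J` is free so that large families of congruences can serve as index.
  Quasivariety-jointly-injective : {A : Algebra 𝓛} {J : Set i} (B : J → Algebra 𝓛) →
    (∀ j → B j ∈ Q) → (h : ∀ j → Hom A (B j)) →
    (∀ {u v} → (∀ j → Algebra._≈_ (B j) (to (h j) u) (to (h j) v)) → Algebra._≈_ A u v) →
    A ∈ Q
  Quasivariety-jointly-injective B B∈Q h injective q q∈Γ ρ premises = injective λ j →
    let open Algebra (B j) in
    trans (eval-hom (h j) (proj₁ conclusion) ρ) (trans
      (B∈Q j q q∈Γ (to (h j) ∘ ρ) (All.map (λ {e} → Holds-hom (h j) e) premises))
      (sym (eval-hom (h j) (proj₂ conclusion) ρ)))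
    where open QuasiEquation q using (conclusion)

  Quasivariety-embedding : {A B : Algebra 𝓛} (h : Hom A B) → IsEmbedding h → B ∈ Q → A ∈ Q
  Quasivariety-embedding {B = B} h injective B∈Q =
    Quasivariety-jointly-injective {J = ⊤ {ℓ}} (λ _ → B) (λ _ → B∈Q) (λ _ → h) (λ e → injective (e _))

  Quasivariety-/diagonal : {A : Algebra 𝓛} → A ∈ Q → (A / diagonal A) ∈ Q
  Quasivariety-/diagonal {A} = Quasivariety-embedding {A / diagonal A} {A}
    (record { func = record { to = id ; cong = id } ; homo = λ _ _ → Algebra.refl A }) id

  Quasivariety-× : {A B : Algebra 𝓛} → A ∈ Q → B ∈ Q → (A ×ᴬ B) ∈ Q
  Quasivariety-× {A} {B} A∈Q B∈Q = Quasivariety-jointly-injective {J = Fin 2}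
    (λ { zero → A ; (suc _) → B }) (λ { zero → A∈Q ; (suc _) → B∈Q })
    (λ { zero → π₁ {B = B} ; (suc _) → π₂ {A = A} }) (λ e → e zero , e (suc zero))

  -- Łoś's theorem for quasi-equations: the premises form a finite list, so they hold together on a
  -- large set of indices.
  Quasivariety-ultraproduct : {I : Set ℓ} (𝓤 : Ultrafilter I) {A : I → Algebra 𝓛} →
    (∀ k → A k ∈ Q) → ultraproduct 𝓤 A ∈ Q
  Quasivariety-ultraproduct 𝓤 {A} A∈Q q q∈Γ ρ ps =
    upward (λ {k} prems →
      trans k (eval-ultraproduct 𝓤 A (proj₁ conclusion) ρ k) (trans k
        (A∈Q k q q∈Γ _ prems)
        (sym k (eval-ultraproduct 𝓤 A (proj₂ conclusion) ρ k))))
      (all-large ps)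
    where
    open QuasiEquation q using (conclusion)
    open Ultrafilter 𝓤
    open module A k = Algebra (A k) using (trans; sym)

    all-large : ∀ {es} → All (Holds (ultraproduct 𝓤 A) ρ) es →
                Large (λ k → All (Holds (A k) (λ v → ρ v k)) es)
    all-large []                   = upward (λ _ → []) whole
    all-large (_∷_ {s , t} eq eqs) = upward
      (λ {k} (e , es) →
        trans k (sym k (eval-ultraproduct 𝓤 A s ρ k))
          (trans k e (eval-ultraproduct 𝓤 A t ρ k)) ∷ es)
      (inter eq (all-large eqs))

-- Epimorphisms and epic subalgebras

ClosedUnderEmbeddings : {𝓛 : Signature ℓ} → Class 𝓛 κ → Set _
ClosedUnderEmbeddings K = ∀ {A B} (h : Hom A B) → IsEmbedding h → B ∈ K → A ∈ K

-- The inclusion of an epic subalgebra is an epimorphism. Conversely the image of an epimorphism is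
-- epic, and it lies in `K` by closure under embeddings.
surjectiveEpimorphisms⇔ : {K : Class 𝓛 κ} → ClosedUnderEmbeddings K →
  HasSurjectiveEpimorphisms K ⇔ NoProperEpicSubalgebras K K
surjectiveEpimorphisms⇔ {K = K} K-embedding = mk⇔ noProper surjective
  where
  noProper : HasSurjectiveEpimorphisms K → NoProperEpicSubalgebras K K
  noProper surjective B P P∈K B∈K epic b
    with surjective (subalgebra B P) B P∈K B∈K (inclusion P)
           (λ C C∈K g g′ eq → epic C C∈K g g′ (curry eq)) b
  ... | z , e = Subuniverse.resp P (e {z} (Algebra.refl B)) (proj₂ z)

  surjective : NoProperEpicSubalgebras K K → HasSurjectiveEpimorphisms K
  surjective noProper A B A∈K B∈K h epi b
    with noProper B Im (K-embedding (inclusion Im) id B∈K) B∈K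
           (λ C C∈K g g′ eq → epi C C∈K g g′
             (λ z → eq (to h z) (z , _ , Algebra.refl B))) b
    where Im = direct-image h full
  ... | z , _ , e = z , λ e′ → Algebra.trans B (Hom.cong h e′) e

𝕊-intro : {K : Class 𝓛 κ} (h : Hom A B) → IsEmbedding h → B ∈ K → A ∈ 𝕊 K
𝕊-intro {A = A} {B = B} h injective B∈K = B , B∈K , direct-image h full ,
  record
    { func = record { to = λ z → to h z , z , _ , B.refl ; cong = Hom.cong h }
    ; homo = Hom.homo h
    } ,
  injective , (λ (_ , z , _ , e) → z , λ e′ → B.trans (Hom.cong h e′) e)
  where module B = Algebra B

𝕊-elim : {K : Class 𝓛 κ} → A ∈ 𝕊 K → ∃[ B ] B ∈ K × Σ[ h ∈ Hom A B ] IsEmbedding h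
𝕊-elim (B , B∈K , P , h , injective , _) = B , B∈K , inclusion P ∘ᴴ h , injective

𝕊-embedding : {K : Class 𝓛 κ} → ClosedUnderEmbeddings (𝕊 K)
𝕊-embedding h injective B∈𝕊K =
  let _ , C∈K , k , k-injective = 𝕊-elim B∈𝕊K
  in 𝕊-intro (k ∘ᴴ h) (injective ∘ k-injective) C∈K

-- Homomorphisms into a subalgebra of a member of `K` can be compared after composing with its
-- embedding.
IsEpic-𝕊 : {K : Class 𝓛 κ} (P : Subuniverse B) → IsEpic K P ⇔ IsEpic (𝕊 K) P
IsEpic-𝕊 P = mk⇔
  (λ epic C C∈𝕊K g g′ eq b →
    let D , D∈K , k , k-injective = 𝕊-elim C∈𝕊K
    in k-injective (epic D D∈K (k ∘ᴴ g) (k ∘ᴴ g′) (λ z z∈P → Hom.cong k (eq z z∈P)) b))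
  (λ epic C C∈K → epic C (𝕊-intro idᴴ id C∈K))

noProperEpicSubalgebras-𝕊⇔ : {L : Class 𝓛 μ} {K : Class 𝓛 κ} →
  NoProperEpicSubalgebras L K ⇔ NoProperEpicSubalgebras L (𝕊 K)
noProperEpicSubalgebras-𝕊⇔ = mk⇔
  (λ noProper B P P∈L B∈L → noProper B P P∈L B∈L ∘ Equivalence.from (IsEpic-𝕊 P))
  (λ noProper B P P∈L B∈L → noProper B P P∈L B∈L ∘ Equivalence.to (IsEpic-𝕊 P))

⊗-intro : {K : Class 𝓛 κ} {L : Class 𝓛 μ} → A ∈ K → B ∈ L → (A ×ᴬ B) ∈ K ⊗ L
⊗-intro {A = A} {B = B} A∈K B∈L = A , B , A∈K , B∈L , idᴴ {A = A ×ᴬ B} , id , λ y → y , id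

ℙᵤ-intro : {𝓛 : Signature ℓ} {I : Set ℓ} {K : Class 𝓛 κ} (𝓤 : Ultrafilter I)
  {A : I → Algebra 𝓛} → (∀ k → A k ∈ K) → ultraproduct 𝓤 A ∈ ℙᵤ K
ℙᵤ-intro 𝓤 {A} A∈K = -, 𝓤 , A , A∈K , idᴴ {A = ultraproduct 𝓤 A} , id , λ y → y , id

product-map : {𝓛 : Signature ℓ} {I : Set ℓ} (𝓤 : Ultrafilter I) {A : Algebra 𝓛}
  {B : I → Algebra 𝓛} → (∀ k → Hom A (B k)) → Hom A (ultraproduct 𝓤 B)
product-map 𝓤 {B = B} h = record
  { func = record
    { to   = λ z k → to (h k) z
    ; cong = λ e → upward (λ {k} _ → Hom.cong (h k) e) whole
    }
  ; homo = λ f xs → upward (λ {k} _ → Hom.homo (h k) f xs) whole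
  }
  where open Ultrafilter 𝓤

-- Gluing with a majority operation

module _ {I : Set i} {J : Set p} (K : J → Pred I ℓ) (m : J → J → J → J)
  (m-₁₂ : ∀ r s t → K r ∩ K s ⊆ K (m r s t))
  (m-₁₃ : ∀ r s t → K r ∩ K t ⊆ K (m r s t))
  (m-₂₃ : ∀ r s t → K s ∩ K t ⊆ K (m r s t))
  where

  -- The Baker-Pixley step: `r`, `s` and `t` may each fail on one set only, and these three sets are
  -- different. So every `X k` lies in two of `K r`, `K s`, `K t`, hence in `K (m r s t)`.
  glue-omissions : ∀ {n} (X : Fin (suc (suc (suc n))) → Pred I ℓ) →
    (∀ k → ∃[ r ] (∀ l → X (punchIn k l) ⊆ K r)) → ∃[ r ] (∀ k → X k ⊆ K r)
  glue-omissions X omit = m r s t , λ where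
      zero                → λ h → m-₂₃ r s t (X₋₁⊆Ks zero h , X₋₂⊆Kt zero h)
      (suc zero)          → λ h → m-₁₃ r s t (X₋₀⊆Kr zero h , X₋₂⊆Kt (suc zero) h)
      (suc (suc zero))    → λ h → m-₁₂ r s t (X₋₀⊆Kr (suc zero) h , X₋₁⊆Ks (suc zero) h)
      (suc (suc (suc k))) → λ h → m-₁₂ r s t (X₋₀⊆Kr (suc (suc k)) h , X₋₁⊆Ks (suc (suc k)) h)
    where
    r = proj₁ (omit zero)
    s = proj₁ (omit (suc zero))
    t = proj₁ (omit (suc (suc zero)))
    X₋₀⊆Kr = proj₂ (omit zero)
    X₋₁⊆Ks = proj₂ (omit (suc zero))
    X₋₂⊆Kt = proj₂ (omit (suc (suc zero)))

  -- Families of at most two sets are settled by `pairs`, with the given element of `J` for the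
  -- empty family. A larger family reduces to its subfamilies with one set left out.
  glue : J → ∀ {n} (X : Fin n → Pred I ℓ) →
    (∀ k l → ∃[ r ] X k ⊆ K r × X l ⊆ K r) → ∃[ r ] (∀ k → X k ⊆ K r)
  glue r {zero}             X pairs = r , λ ()
  glue _ {suc zero}         X pairs =
    let r , X₀⊆Kr , _ = pairs zero zero
    in r , λ { zero → X₀⊆Kr }
  glue _ {suc (suc zero)}   X pairs =
    let r , X₀⊆Kr , X₁⊆Kr = pairs zero (suc zero)
    in r , λ { zero → X₀⊆Kr ; (suc zero) → X₁⊆Kr }
  glue r {suc (suc (suc n))} X pairs = glue-omissions X λ k →
    glue r {suc (suc n)} (X ∘ punchIn k) (λ l l′ → pairs (punchIn k l) (punchIn k l′))

module Classical (em : ∀ {a} → ExcludedMiddle a) (zorn : ZornsLemma) where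

  -- Excluded middle makes propositions independent of the universe level, so that
  -- unions and intersections of large families stay at level ℓ.
  Small : Set a → Set ℓ
  Small {ℓ = ℓ} P = Lift ℓ (True (em {P = P}))

  shrink : {P : Set a} → P → Small {ℓ = ℓ} P
  shrink z = lift (fromWitness z)

  expand : {P : Set a} → Small {ℓ = ℓ} P → P
  expand (lift z) = toWitness z

  -- Cells of a finite family of sets

  module _ {I : Set i} {J : Set p} (K : J → Pred I ℓ) where

    -- The atoms of the field of sets generated by finitely many `K r`, possibly with empty sets
    -- among them. They replace the points of `I` by a finite list, to which `glue` applies.
    cells : List J → List (Pred I ℓ)
    cells []       = [ (λ _ → ⊤) ]
    cells (r ∷ rs) = map (K r ∩_) (cells rs) ++ map (∁ (K r) ∩_) (cells rs)

    cells-cover : ∀ rs k → Any (k ∈_) (cells rs)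
    cells-cover []       k = here _
    cells-cover (r ∷ rs) k with em {P = k ∈ K r}
    ... | yes k∈Kr = Any.++⁺ˡ (Any.map⁺ (Any.map (k∈Kr ,_) (cells-cover rs k)))
    ... | no  k∉Kr = Any.++⁺ʳ _ (Any.map⁺ (Any.map (k∉Kr ,_) (cells-cover rs k)))

    cells-homogeneous : ∀ rs → All (λ X → All (λ r → X ⊆ K r ⊎ X ⊆ ∁ (K r)) rs) (cells rs)
    cells-homogeneous []       = [] ∷ []
    cells-homogeneous (r ∷ rs) = All.++⁺
      (All.map⁺ (All.map (λ hs → inj₁ proj₁ ∷ All.map restrict hs) (cells-homogeneous rs)))
      (All.map⁺ (All.map (λ hs → inj₂ proj₁ ∷ All.map restrict hs) (cells-homogeneous rs)))
      where
      restrict : ∀ {X Y : Pred I ℓ} {s} → X ⊆ K s ⊎ X ⊆ ∁ (K s) →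
                 Y ∩ X ⊆ K s ⊎ Y ∩ X ⊆ ∁ (K s)
      restrict (inj₁ h) = inj₁ (h ∘′ proj₂)
      restrict (inj₂ h) = inj₂ (h ∘′ proj₂)

    module _ (m : J → J → J → J)
      (m-₁₂ : ∀ r s t → K r ∩ K s ⊆ K (m r s t))
      (m-₁₃ : ∀ r s t → K r ∩ K t ⊆ K (m r s t))
      (m-₂₃ : ∀ r s t → K s ∩ K t ⊆ K (m r s t))
      where

      -- A `K r` with `r` in `rs` that meets a cell contains it, so what `pairs` gives for two
      -- points holds for their cells.
      cover-pairs⇒cover : J → ∀ rs → (∀ k l → Any (λ r → k ∈ K r × l ∈ K r) rs) →
                          ∃[ r ] Universal (K r)
      cover-pairs⇒cover r₀ rs pairs =
        let r , covers = glue K m m-₁₂ m-₁₃ m-₂₃ r₀ (lookup (cells rs)) cell-pairs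
        in r , λ k → covers (Any.index (cells-cover rs k)) (Any.lookup-index (cells-cover rs k))
        where
        Cell = Fin (length (cells rs))

        cell : Cell → Pred I ℓ
        cell = lookup (cells rs)

        cell⊆ : ∀ X {k r} → r Membership.∈ rs → k ∈ cell X → k ∈ K r → cell X ⊆ K r
        cell⊆ X r∈rs k∈X k∈Kr
          with All.lookup (All.lookup (cells-homogeneous rs) (∈-lookup X)) r∈rs
        ... | inj₁ X⊆Kr  = X⊆Kr
        ... | inj₂ X⊆∁Kr = contradiction k∈Kr (X⊆∁Kr k∈X)

        cell-pairs : ∀ X Y → ∃[ r ] cell X ⊆ K r × cell Y ⊆ K r
        cell-pairs X Y with em {P = Satisfiable (cell X)} | em {P = Satisfiable (cell Y)}
        ... | yes (k , k∈X) | yes (l , l∈Y) =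
          let r , r∈rs , k∈Kr , l∈Kr = Membership.find (pairs k l)
          in r , cell⊆ X r∈rs k∈X k∈Kr , cell⊆ Y r∈rs l∈Y l∈Kr
        -- An empty cell lies in every `K r`, so the other cell alone decides.
        ... | yes (k , k∈X) | no ∄Y =
          let r , r∈rs , k∈Kr , _ = Membership.find (pairs k k)
          in r , cell⊆ X r∈rs k∈X k∈Kr , λ l∈Y → contradiction (-, l∈Y) ∄Y
        ... | no ∄X | yes (l , l∈Y) =
          let r , r∈rs , _ , l∈Kr = Membership.find (pairs l l)
          in r , (λ k∈X → contradiction (-, k∈X) ∄X) , cell⊆ Y r∈rs l∈Y l∈Kr
        ... | no ∄X | no ∄Y =
          r₀ , (λ k∈X → contradiction (-, k∈X) ∄X) , λ l∈Y → contradiction (-, l∈Y) ∄Y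

  -- Maximal elements and ultrafilters

  -- Common to both uses of Zorn's lemma: filters are ordered through their large sets, congruences
  -- through their graphs.
  module Inclusion {P : Set c} {X : Set x} (ext : P → Pred X ℓ) where

    inclusionPoset : Poset c (x ⊔ ℓ) (x ⊔ ℓ)
    inclusionPoset = record
      { Carrier        = P
      ; _≈_            = λ r s → ext r ⊆ ext s × ext s ⊆ ext r
      ; _≤_            = λ r s → ext r ⊆ ext s
      ; isPartialOrder = record
        { isPreorder = record
          { isEquivalence = record
            { refl  = id , id
            ; sym   = λ (e , e′) → e′ , e
            ; trans = λ (e , e′) (f , f′) → f ∘′ e , e′ ∘′ f′
            }
          ; reflexive = proj₁
          ; trans     = λ e f → f ∘′ e
          }
        ; antisym    = _,_
        }
      }

    -- The empty chain is bounded by `r₀`, which leaves the chains whose union can serve as a bound.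
    zorn-inhabited : P →
      ((C : Pred P c) → IsChain inclusionPoset C → Satisfiable C →
        ∃[ u ] IsUpperBound inclusionPoset C u) →
      ∃[ r ] IsMaximal inclusionPoset r
    zorn-inhabited r₀ bound = zorn inclusionPoset λ C chain → bound′ C chain em
      where
      bound′ : ∀ C → IsChain inclusionPoset C → Dec (Satisfiable C) →
               ∃[ u ] IsUpperBound inclusionPoset C u
      bound′ C chain (yes inhabited) = bound C chain inhabited
      bound′ C chain (no empty)      = r₀ , λ r r∈C → contradiction (r , r∈C) empty

    ⋃ : Pred P c → Pred X ℓ
    ⋃ C z = Small (∃[ r ] r ∈ C × z ∈ ext r)

    ⊆⋃ : ∀ {C : Pred P c} {r} → r ∈ C → ext r ⊆ ⋃ C
    ⊆⋃ r∈C z∈r = shrink (-, r∈C , z∈r)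

    -- Of two members of a chain the larger is kept. This makes finitary conditions pass to the
    -- union: intersections, transitivity, operations, quasi-equations.
    chain-bound : ∀ {C : Pred P c} → IsChain inclusionPoset C → Satisfiable C →
      ∀ {zs} → All (_∈ ⋃ C) zs → ∃[ r ] r ∈ C × All (_∈ ext r) zs
    chain-bound chain (r , r∈C) []       = r , r∈C , []
    chain-bound chain inh       (h ∷ hs)
      with expand h | chain-bound chain inh hs
    ... | r , r∈C , z∈r | s , s∈C , zs∈s with chain r s r∈C s∈C
    ... | inj₁ r⊆s = s , s∈C , r⊆s z∈r ∷ zs∈s
    ... | inj₂ s⊆r = r , r∈C , z∈r ∷ All.map s⊆r zs∈s

  record ProperFilter {I J : Set ℓ} (Y : J → Pred I ℓ) : Set (lsuc ℓ) where
    field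
      Large  : Pred (Pred I ℓ) ℓ
      upward : ∀ {X Z} → X ⊆ Z → Large X → Large Z
      whole  : Large (λ _ → ⊤)
      inter  : ∀ {X Z} → Large X → Large Z → Large (X ∩ Z)
      proper : ¬ Large ∅
      basic  : ∀ j → Large (Y j)

  module _ {I J : Set ℓ} {Y : J → Pred I ℓ} where

    open ProperFilter
    open Inclusion {P = ProperFilter Y} Large

    ⋃-filter : (C : Pred (ProperFilter Y) (lsuc ℓ)) → IsChain inclusionPoset C →
               Satisfiable C → ProperFilter Y
    ⋃-filter C chain inh@(F , F∈C) = record
      { Large  = ⋃ C
      ; upward = λ X⊆Z h → let G , G∈C , X∈G = expand h in ⊆⋃ G∈C (upward G X⊆Z X∈G)
      ; whole  = ⊆⋃ F∈C (whole F)
      ; inter  = λ h k → inter-⋃ (chain-bound chain inh (h ∷ k ∷ []))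
      ; proper = λ h → let G , _ , ∅∈G = expand h in proper G ∅∈G
      ; basic  = λ j → ⊆⋃ F∈C (basic F j)
      }
      where
      inter-⋃ : ∀ {X Z} → ∃[ G ] G ∈ C × All (_∈ Large G) (X ∷ Z ∷ []) → ⋃ C (X ∩ Z)
      inter-⋃ (G , G∈C , X∈G ∷ Z∈G ∷ []) = ⊆⋃ G∈C (inter G X∈G Z∈G)

    -- The filter generated by `F` and `X`. It is proper because for empty `Z` the set required to
    -- be in `F` is `∁ X`.
    adjoin : (F : ProperFilter Y) (X : Pred I ℓ) → ¬ Large F (∁ X) → ProperFilter Y
    adjoin F X ∁X∉F = record
      { Large  = λ Z → Large F (λ k → k ∈ X → k ∈ Z)
      ; upward = λ Z⊆Z′ → upward F (λ h k∈X → Z⊆Z′ (h k∈X))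
      ; whole  = upward F (λ _ _ → _) (whole F)
      ; inter  = λ h h′ → upward F (λ (z , z′) k∈X → z k∈X , z′ k∈X) (inter F h h′)
      ; proper = λ h → ∁X∉F (upward F (λ z k∈X → lower (z k∈X)) h)
      ; basic  = λ j → upward F (λ z _ → z) (basic F j)
      }

    ultrafilter-extending : ProperFilter Y →
      Σ[ 𝓤 ∈ Ultrafilter I ] (∀ j → Ultrafilter.Large 𝓤 (Y j))
    ultrafilter-extending F₀ = record
      { Large  = Large F
      ; upward = upward F
      ; whole  = whole F
      ; inter  = inter F
      ; proper = proper F
      ; ultra  = ultra
      } , basic F
      where
      maximal = zorn-inhabited F₀ λ C chain inh → ⋃-filter C chain inh , λ G → ⊆⋃
      F = proj₁ maximal

      ultra : ∀ X → Large F X ⊎ Large F (∁ X)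
      ultra X with em {P = Large F (∁ X)}
      ... | yes ∁X∈F = inj₂ ∁X∈F
      ... | no  ∁X∉F = inj₁
        -- Maximality puts `adjoin F X` inside `F`, and `X` belongs to `adjoin F X`.
        (proj₁ (proj₂ maximal (adjoin F X ∁X∉F) (upward F (λ z _ → z)))
          (upward F (λ _ z → z) (whole F)))

  -- Compactness of the space of ultrafilters on `I`. Without a finite subcover the complements of
  -- the `Y j` generate a proper filter, and an ultrafilter extending it contains no `Y j`.
  finite-subcover : {I J : Set ℓ} (Y : J → Pred I ℓ) →
    (∀ 𝓤 → ∃[ j ] Ultrafilter.Large 𝓤 (Y j)) → ∃[ js ] (∀ k → Any (λ j → k ∈ Y j) js)
  finite-subcover {ℓ} {I} {J} Y some-large = decidable-stable em λ no-cover →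
    let 𝓤 , ∁Y-large = ultrafilter-extending (uncovered no-cover)
        open Ultrafilter 𝓤
        j , Yj-large = some-large 𝓤
    in proper (upward (λ (k∈Y , k∉Y) → contradiction k∈Y k∉Y) (inter Yj-large (∁Y-large j)))
    where
    uncovered : ¬ (∃[ js ] (∀ k → Any (λ j → k ∈ Y j) js)) → ProperFilter (∁ ∘ Y)
    uncovered no-cover = record
      { Large  = λ Z → ∃[ js ] (∀ k → ¬ Any (λ j → k ∈ Y j) js → k ∈ Z)
      ; upward = λ X⊆Z (js , h) → js , λ k u → X⊆Z (h k u)
      ; whole  = [] , _
      ; inter  = λ (js , h) (js′ , h′) → js ++ js′ ,
                   λ k u → h k (u ∘ Any.++⁺ˡ) , h′ k (u ∘ Any.++⁺ʳ js)
      ; proper = λ (js , h) → no-cover (js , λ k → decidable-stable em λ u → lower (h k u))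
      ; basic  = λ j → [ j ] , λ k u k∈Y → u (here k∈Y)
      }

  -- Relatively subdirectly irreducible algebras

  module _ {𝓛 : Signature ℓ} (Γ : Pred (QuasiEquation 𝓛) ℓ) where

    private
      Q = Quasivariety Γ
      S = ℙᵤ (RSI Q)

    -- The quotient by the intersection maps jointly injectively into the quotients by the members
    -- of `X`, hence stays in `Q`.
    ⋂-congruence : (A : Algebra 𝓛) → Pred (RelCongruence Q A) κ → RelCongruence Q A
    ⋂-congruence {κ = κ} A X = θ , Quasivariety-jointly-injective Γ
        {J = Σ (RelCongruence Q A) X} (λ ((ψ , _) , _) → A / ψ) (λ ((_ , q) , _) → q)
        (λ ((ψ , _) , ψ∈X) → record
          { func = record { to = id ; cong = λ e → expand e (-, ψ∈X) }
          ; homo = λ f xs → reflexive ψ (Algebra.refl A)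
          })
        shrink
      where
      θ : Congruence A
      θ = record
        { _∼_           = λ u v → Small (∀ (r : Σ (RelCongruence Q A) X) → _∼_ (proj₁ (proj₁ r)) u v)
        ; reflexive     = λ e → shrink λ ((ψ , _) , _) → reflexive ψ e
        ; isEquivalence = record
          { refl  = shrink λ ((ψ , _) , _) → ≡.refl ψ
          ; sym   = λ e → shrink λ r@((ψ , _) , _) → ≡.sym ψ (expand e r)
          ; trans = λ e e′ → shrink λ r@((ψ , _) , _) → ≡.trans ψ (expand e r) (expand e′ r)
          }
        ; compatible    = λ f es → shrink λ r@((ψ , _) , _) → compatible ψ f (λ j → expand (es j) r)
        }

    module _ {A : Algebra 𝓛} (A∈Q : A ∈ Q) {u v} (u≉v : ¬ Algebra._≈_ A u v) where

      private
        module A = Algebra A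

      Separating : Set (lsuc ℓ)
      Separating = Σ[ θ ∈ RelCongruence Q A ] ¬ _∼_ (proj₁ θ) u v

      graph : Separating → Pred (A.Carrier × A.Carrier) ℓ
      graph ((θ , _) , _) = uncurry (_∼_ θ)

      open Inclusion graph

      -- Arities and lists of premises are finite, so each closure condition on the union involves
      -- finitely many pairs, which lie in one member of the chain.
      ⋃-separating : (C : Pred Separating (lsuc ℓ)) → IsChain inclusionPoset C →
                     Satisfiable C → Separating
      ⋃-separating C chain inh@(((θ₀ , _) , _) , θ₀∈C) = (θ , A/θ∈Q) ,
        λ e → let (_ , u≁v) , _ , u∼v = expand e in u≁v u∼v
        where
        bound = chain-bound chain inh

        θ : Congruence A
        θ = record
          { _∼_           = curry (⋃ C)
          ; reflexive     = λ e → ⊆⋃ θ₀∈C (reflexive θ₀ e)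
          ; isEquivalence = record
            { refl  = ⊆⋃ θ₀∈C (≡.refl θ₀)
            ; sym   = λ e → let ((ψ , _) , _) , ψ∈C , e′ = expand e in ⊆⋃ ψ∈C (≡.sym ψ e′)
            ; trans = λ e e′ → trans-⋃ (bound (e ∷ e′ ∷ []))
            }
          ; compatible    = λ f es →
              let ((ψ , _) , _) , ψ∈C , es′ = bound (All.tabulate⁺ es)
              in ⊆⋃ ψ∈C (compatible ψ f (All.tabulate⁻ es′))
          }
          where
          trans-⋃ : ∀ {x y z} → ∃[ ψ ] ψ ∈ C × All (_∈ graph ψ) ((x , y) ∷ (y , z) ∷ []) →
                       ⋃ C (x , z)
          trans-⋃ (((ψ , _) , _) , ψ∈C , e ∷ e′ ∷ []) = ⊆⋃ ψ∈C (≡.trans ψ e e′)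

        A/θ∈Q : (A / θ) ∈ Q
        A/θ∈Q q q∈Γ ρ premises =
          let ((ψ , A/ψ∈Q) , _) , ψ∈C , es =
                bound (All.map⁺ (All.map (λ {e} → Holds-quotient⇒ θ e) premises))
          in Holds-quotient⇐ θ conclusion (⊆⋃ ψ∈C (Holds-quotient⇒ ψ conclusion
               (A/ψ∈Q q q∈Γ ρ (All.map (λ {e} → Holds-quotient⇐ ψ e) (All.map⁻ es)))))
          where open QuasiEquation q using (conclusion)

      -- A relative congruence of `A / θ` that does not relate `u` and `v` pulls back to a
      -- separating one above `θ`, so by maximality it is the diagonal. If the diagonal is not in
      -- `X`, every member of `X` therefore relates `u` and `v`.
      maximal⇒RSI : ∀ m → IsMaximal inclusionPoset m → (A / proj₁ (proj₁ m)) ∈ RSI Q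
      maximal⇒RSI ((θ , A/θ∈Q) , u≁v) maximal = A/θ∈Q , A/θ/Δ∈Q , irreducible
        where
        A/θ = A / θ

        A/θ/Δ∈Q : (A/θ / diagonal A/θ) ∈ Q
        A/θ/Δ∈Q = Quasivariety-/diagonal Γ {A/θ} A/θ∈Q

        pull : RelCongruence Q A/θ → RelCongruence Q A
        pull (ψ , A/ψ∈Q) = record
          { _∼_           = _∼_ ψ
          ; reflexive     = reflexive ψ ∘ reflexive θ
          ; isEquivalence = isEquivalence ψ
          ; compatible    = compatible ψ
          } , A/ψ∈Q

        module _ (X : Pred (RelCongruence Q A/θ) (lsuc ℓ))
          (infimum : IsInfimum (relCongruences Q A/θ) X (diagonal A/θ , A/θ/Δ∈Q)) where

          relates : ¬ (∃[ ψ ] ψ ∈ X × Poset._≈_ (relCongruences Q A/θ) ψ (diagonal A/θ , A/θ/Δ∈Q)) →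
                    ∀ ψ → ψ ∈ X → _∼_ (proj₁ ψ) u v
          relates Δ∉X ψ ψ∈X = decidable-stable em λ u≁ψv →
            let ψ⊑θ , _ = maximal (pull ψ , u≁ψv) (proj₁ infimum ψ ψ∈X)
            in Δ∉X (ψ , ψ∈X , (λ e → ψ⊑θ e) , proj₁ infimum ψ ψ∈X)

        irreducible : CompletelyMeetIrreducible (relCongruences Q A/θ) (diagonal A/θ , A/θ/Δ∈Q)
        irreducible X infimum = decidable-stable em λ Δ∉X →
          -- The intersection of `X` is a lower bound, hence below the diagonal of `A / θ`, which is
          -- `θ`; yet it relates `u` and `v`.
          u≁v (proj₂ infimum (⋂-congruence A/θ X) (λ ψ ψ∈X e → expand e (ψ , ψ∈X))
            (shrink λ (ψ , ψ∈X) → relates X infimum Δ∉X ψ ψ∈X))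

      -- Abstract because unfolding the use of Zorn's lemma is prohibitively slow.
      abstract
        separate : ∃[ D ] D ∈ RSI Q × Σ[ h ∈ Hom A D ] ¬ Algebra._≈_ D (to h u) (to h v)
        separate =
          let m@((θ , _) , u≁v) , maximal =
                zorn-inhabited base λ C chain inh → ⋃-separating C chain inh , λ _ → ⊆⋃
          in A / θ , maximal⇒RSI m maximal , quotient-map θ , u≁v
          where
          base : Separating
          base = (diagonal A , Quasivariety-/diagonal Γ {A} A∈Q) , u≉v

    -- Comparison of S ⊗ S with Q

    S⊆Q : S ⊆ Q
    S⊆Q (_ , 𝓤 , B , B∈RSI , h , injective , _) =
      Quasivariety-embedding Γ h injective
        (Quasivariety-ultraproduct Γ 𝓤 {B} (λ k → proj₁ (B∈RSI k)))

    S⊗S⊆Q : S ⊗ S ⊆ Q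
    S⊗S⊆Q (C , D , C∈S , D∈S , h , injective , _) =
      Quasivariety-embedding Γ h injective (Quasivariety-× Γ {C} {D} (S⊆Q C∈S) (S⊆Q D∈S))

    𝕊[S⊗S]⊆Q : 𝕊 (S ⊗ S) ⊆ Q
    𝕊[S⊗S]⊆Q A∈𝕊 =
      let _ , B∈S⊗S , h , injective = 𝕊-elim A∈𝕊
      in Quasivariety-embedding Γ h injective (S⊗S⊆Q B∈S⊗S)

    principal : {I : Set ℓ} → I → Ultrafilter I
    principal k = record
      { Large  = k ∈_
      ; upward = λ X⊆Y → X⊆Y
      ; whole  = _
      ; inter  = _,_
      ; proper = lower
      ; ultra  = λ X → toSum em
      }

    -- A relatively subdirectly irreducible `D` is, up to isomorphism, its own ultrapower over a
    -- one-element set, and the ultrapower embeds diagonally in its square.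
    separate-S⊗S : A ∈ Q → ∀ {u v} → ¬ Algebra._≈_ A u v →
      ∃[ D ] D ∈ S ⊗ S × Σ[ h ∈ Hom A D ] ¬ Algebra._≈_ D (to h u) (to h v)
    separate-S⊗S A∈Q u≉v =
      let D , D∈RSI , h , hu≉hv = separate A∈Q u≉v
          𝓤 = principal {I = ⊤} _
          U = ultraproduct 𝓤 (λ _ → D)
          U∈S = ℙᵤ-intro {K = RSI Q} 𝓤 (λ _ → D∈RSI)
          h′ = product-map 𝓤 (λ _ → h)
      in (U ×ᴬ U) , ⊗-intro {K = S} {L = S} U∈S U∈S , ⟨ h′ , h′ ⟩ , hu≉hv ∘ proj₁

    IsEpic-S⊗S⇒Q : (P : Subuniverse B) → IsEpic (S ⊗ S) P → IsEpic Q P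
    IsEpic-S⊗S⇒Q P epic C C∈Q g g′ eq b = decidable-stable em λ gb≉g′b →
      let D , D∈S⊗S , h , h-separates = separate-S⊗S C∈Q gb≉g′b
      in h-separates (epic D D∈S⊗S (h ∘ᴴ g) (h ∘ᴴ g′) (λ z z∈P → Hom.cong h (eq z z∈P)) b)

    -- From pairs of homomorphisms to a whole family

    module _ (noProper : NoProperEpicSubalgebras (𝕊 (S ⊗ S)) (S ⊗ S))
      {B : Algebra 𝓛} (P : Subuniverse B) (epic : IsEpic Q P) (b : Algebra.Carrier B) where

      -- E stands for the image of B in C × D.
      agree-on-pair : {C D : Algebra 𝓛} → C ∈ S → D ∈ S → (g : Hom B C) (h : Hom B D) →
        ∃[ z ] z ∈ carrier P × Algebra._≈_ C (to g z) (to g b) × Algebra._≈_ D (to h z) (to h b)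
      agree-on-pair {C} {D} C∈S D∈S g h =
        -- Membership of `b` in `P′` is already the goal, since equality in `E` is equality in both
        -- coordinates.
        noProper E P′
          (𝕊-intro (kernel-map ⟨ g , h ⟩ ∘ᴴ inclusion P′) id C×D∈S⊗S)
          (𝕊-intro (kernel-map ⟨ g , h ⟩) id C×D∈S⊗S)
          (λ F F∈S⊗S k k′ eq → epic F (S⊗S⊆Q F∈S⊗S) (k ∘ᴴ q) (k′ ∘ᴴ q)
            (λ z z∈P → eq z (z , z∈P , Algebra.refl E)))
          b
        where
        E = B / kernel ⟨ g , h ⟩
        q = quotient-map (kernel ⟨ g , h ⟩)
        P′ = direct-image q P
        C×D∈S⊗S = ⊗-intro C∈S D∈S

      module _ (majorityTerm : HasMajorityTerm Q) {I : Set ℓ} {target : I → Algebra 𝓛}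
        (target∈RSI : ∀ k → target k ∈ RSI Q) (g : ∀ k → Hom B (target k)) where

        private
          module C k = Algebra (target k)

          t = proj₁ majorityTerm

          J = Σ (Algebra.Carrier B) (carrier P)

        K : J → Pred I ℓ
        K (z , _) k = C._≈_ k (to (g k) z) (to (g k) b)

        vector : ∀ {X : Set ℓ} → X → X → X → Fin 3 → X
        vector r s t = r Vector.∷ s Vector.∷ t Vector.∷ Vector.[]

        m : J → J → J → J
        m (r , r∈P) (s , s∈P) (t′ , t′∈P) = ⟦ t ⟧ B (vector r s t′) ,
          eval-closed P t λ { zero → r∈P ; (suc zero) → s∈P ; (suc (suc zero)) → t′∈P }

        eval-m : ∀ r s t′ k → C._≈_ k (to (g k) (proj₁ (m r s t′)))
          (⟦ t ⟧ (target k) (vector (to (g k) (proj₁ r)) (to (g k) (proj₁ s)) (to (g k) (proj₁ t′))))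
        eval-m r s t′ k = C.trans k (eval-hom (g k) t _) (eval-cong (target k) t λ where
          zero             → C.refl k
          (suc zero)       → C.refl k
          (suc (suc zero)) → C.refl k)

        cong-m : ∀ k {x y z x′ y′ z′} → C._≈_ k x x′ → C._≈_ k y y′ → C._≈_ k z z′ →
          C._≈_ k (⟦ t ⟧ (target k) (vector x y z)) (⟦ t ⟧ (target k) (vector x′ y′ z′))
        cong-m k e e′ e″ = eval-cong (target k) t λ where
          zero             → e
          (suc zero)       → e′
          (suc (suc zero)) → e″

        majority : ∀ k x y → _
        majority k = proj₂ majorityTerm (target k) (proj₁ (target∈RSI k))

        -- An ultrafilter on `I × I` yields two ultraproducts of the targets, along the two
        -- projections, both in `S`. Agreement of `z` with `b` in them says that two sets of pairs
        -- are large.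
        pairs : ∃[ js ] (∀ p → Any (λ j → proj₁ p ∈ K j × proj₂ p ∈ K j) js)
        pairs = finite-subcover (λ j p → proj₁ p ∈ K j × proj₂ p ∈ K j) λ 𝓤 →
          let open Ultrafilter 𝓤
              z , z∈P , e , e′ = agree-on-pair
                (ℙᵤ-intro {K = RSI Q} 𝓤 (target∈RSI ∘ proj₁))
                (ℙᵤ-intro {K = RSI Q} 𝓤 (target∈RSI ∘ proj₂))
                (product-map 𝓤 (g ∘ proj₁)) (product-map 𝓤 (g ∘ proj₂))
          in (z , z∈P) , inter e e′

        -- Where two of three elements agree with `b` under `g k`, the majority term returns that
        -- common value; so `m` meets the hypotheses of gluing.
        agree-on-family : ∃[ j ] Universal (K j)
        agree-on-family = cover-pairs⇒cover K m
          (λ r s t′ {k} (e , e′) → C.trans k (eval-m r s t′ k)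
            (C.trans k (cong-m k e e′ (C.refl k)) (proj₁ (majority k _ _))))
          (λ r s t′ {k} (e , e′) → C.trans k (eval-m r s t′ k)
            (C.trans k (cong-m k e (C.refl k) e′) (proj₁ (proj₂ (majority k _ _)))))
          (λ r s t′ {k} (e , e′) → C.trans k (eval-m r s t′ k)
            (C.trans k (cong-m k (C.refl k) e e′) (proj₂ (proj₂ (majority k _ _)))))
          (Subuniverse.nonempty P) (proj₁ pairs) (curry (proj₂ pairs))

    noProperEpicSubalgebras-S⊗S⇒Q : HasMajorityTerm Q →
      NoProperEpicSubalgebras (𝕊 (S ⊗ S)) (S ⊗ S) → NoProperEpicSubalgebras Q Q
    noProperEpicSubalgebras-S⊗S⇒Q majorityTerm noProper B P _ B∈Q epic b =
      let (z , z∈P) , agree = agree-on-family noProper P epic b majorityTerm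
            (λ ((_ , _ , u≉v) : I) → proj₁ (proj₂ (separate B∈Q u≉v)))
            (λ (_ , _ , u≉v) → proj₁ (proj₂ (proj₂ (separate B∈Q u≉v))))
      in Subuniverse.resp P
           -- Were `z` and `b` distinct, they would form an index in `I`, and their own separating
           -- homomorphism would identify them.
           (decidable-stable em λ z≉b → proj₂ (proj₂ (proj₂ (separate B∈Q z≉b))) (agree (_ , _ , z≉b)))
           z∈P
      where
      module B = Algebra B

      I : Set ℓ
      I = Σ[ u ∈ B.Carrier ] Σ[ v ∈ B.Carrier ] ¬ u B.≈ v

    noProperEpicSubalgebras-Q⇒S⊗S :
      NoProperEpicSubalgebras Q Q → NoProperEpicSubalgebras (𝕊 (S ⊗ S)) (S ⊗ S)
    noProperEpicSubalgebras-Q⇒S⊗S noProper B P P∈𝕊 B∈𝕊 epic =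
      noProper B P (𝕊[S⊗S]⊆Q P∈𝕊) (𝕊[S⊗S]⊆Q B∈𝕊) (IsEpic-S⊗S⇒Q P epic)

theorem10 : (∀ {a} → ExcludedMiddle a) → ZornsLemma →
  ∀ {ℓ} {𝓛 : Signature ℓ} (Γ : Pred (QuasiEquation 𝓛) ℓ) →
  let Q = Quasivariety Γ
      S = ℙᵤ (RSI Q)
  in HasMajorityTerm Q →
    (HasSurjectiveEpimorphisms Q ⇔ NoProperEpicSubalgebras Q Q)
    × (NoProperEpicSubalgebras Q Q ⇔ NoProperEpicSubalgebras (𝕊 (S ⊗ S)) (S ⊗ S))
    × (NoProperEpicSubalgebras (𝕊 (S ⊗ S)) (S ⊗ S) ⇔ HasSurjectiveEpimorphisms (𝕊 (S ⊗ S)))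
theorem10 em zorn Γ majorityTerm =
    surjectiveEpimorphisms⇔ (Quasivariety-embedding Γ)
  , mk⇔ (noProperEpicSubalgebras-Q⇒S⊗S Γ) (noProperEpicSubalgebras-S⊗S⇒Q Γ majorityTerm)
  -- Testing epicness in `𝕊 (S ⊗ S)` instead of `S ⊗ S` brings the condition into the form of the
  -- first equivalence.
  , (⇔-sym (surjectiveEpimorphisms⇔ 𝕊-embedding) ⇔-∘ noProperEpicSubalgebras-𝕊⇔)
  where open Classical em zorn
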